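{- For every integer $n \ge 9$, we have $rd_o(n) > rd_e(n)$, where $rd_o(n)$ denotes the number of partitions with perimeter $n$ into distinct parts having more odd parts than even parts, and $rd_e(n)$ denotes the number of partitions with perimeter $n$ into distinct parts having more even parts than odd parts.
   Context: A partition is a finite nonempty sequence of positive integers $\pi = (\pi_1, \pi_2, \ldots, \pi_r)$ with $\pi_1 \ge \pi_2 \ge \cdots \ge \pi_r$; the $\pi_i$ are its parts. It has distinct parts if $\pi_1 > \pi_2 > \cdots > \pi_r$. The Young diagram of $\pi$ is the left-justified array of boxes whose $i$-th row from the top contains $\pi_i$ boxes. The hook length of a box is the number of boxes directly to its right, plus the number of boxes directly below it, plus $1$. The perimeter of $\pi$ is the largest hook length of $\pi$; equivalently, it equals $\pi_1 + r - 1$ (largest part plus number of parts minus one). The partitions counted by $rd_o(n)$ and $rd_e(n)$ are those with perimeter equal to $n$; the sum of the parts is not fixed. -}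

module Defs where

open import Data.Empty using (⊥-elim)
open import Data.List.Base
  using (List; []; _∷_; _++_; map; filter; length; upTo)
open import Data.List.Extrema.Nat using (max; xs≤max)
open import Data.List.Membership.Propositional using (_∈_)
open import Data.List.Membership.Propositional.Properties
  using (∈-filter⁺; ∈-filter⁻; ∈-map⁺; ∈-map⁻; ∈-++⁺ˡ; ∈-++⁺ʳ; ∈-++⁻)
open import Data.List.Properties using (∷-injectiveʳ)
open import Data.List.Relation.Unary.All using (All; []; _∷_; all?)
open import Data.List.Relation.Unary.AllPairs using ([]; _∷_)
open import Data.List.Relation.Unary.Any using (here; there)
open import Data.List.Relation.Unary.Linked using (Linked; linked?; _∷_)
open import Data.List.Relation.Unary.Unique.Propositional using (Unique)
import Data.List.Relation.Unary.Unique.Propositional.Properties as Unique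
open import Data.Nat.Base
  using (ℕ; zero; suc; parity; _+_; _∸_; _≤_; _<_; _≥_; _>_; z≤n; s≤s⁻¹)
open import Data.Nat.Properties as ℕ
  using (≤-refl; ≤-trans; <-irrefl; m≤n⇒m≤1+n; m≤n⇒m<n∨m≡n; m≤m+n
        ; +-comm; +-monoˡ-≤; _<?_; _>?_; _≥?_)
open import Data.Parity.Base using (0ℙ; 1ℙ)
open import Data.Parity.Properties using () renaming (_≟_ to _≟ℙ_)
open import Data.Product.Base using (_×_; _,_; proj₁; proj₂)
open import Data.Sum.Base using (inj₁; inj₂)
open import Function.Bundles using (_⇔_; mk⇔)
open import Relation.Binary.PropositionalEquality
  using (_≡_; _≢_; refl; subst)
open import Relation.Nullary.Decidable using (yes; no; _×-dec_)
open import Relation.Nullary.Negation using (¬_)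
open import Relation.Unary using (Pred; Decidable)
open import Level using (0ℓ)

IsPartition : Pred (List ℕ) 0ℓ
IsPartition π = π ≢ [] × All (_> 0) π × Linked _≥_ π

DistinctParts : Pred (List ℕ) 0ℓ
DistinctParts = Linked _>_

-- Columns are numbered from 0. The box of the first row p in column j has
-- p ∸ suc j boxes to its right, and the boxes below it lie in the rows of π
-- with more than j boxes.
hookLengths : List ℕ → List ℕ
hookLengths []      = []
hookLengths (p ∷ π) =
  map (λ j → (p ∸ suc j) + length (filter (j <?_) π) + 1) (upTo p)
    ++ hookLengths π

-- Hook lengths are positive, so the initial bound 0 is not attained when π is a
-- partition.
perimeter : List ℕ → ℕ
perimeter π = max 0 (hookLengths π)

#odd #even : List ℕ → ℕ
#odd  π = length (filter (λ p → parity p ≟ℙ 1ℙ) π)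
#even π = length (filter (λ p → parity p ≟ℙ 0ℙ) π)

RDₒ RDₑ : ℕ → Pred (List ℕ) 0ℓ
RDₒ n π = IsPartition π × DistinctParts π × perimeter π ≡ n × #odd π > #even π
RDₑ n π = IsPartition π × DistinctParts π × perimeter π ≡ n × #even π > #odd π

-- The number of lists satisfying P is the length of any such enumeration.
record Enumeration (P : Pred (List ℕ) 0ℓ) : Set where
  field
    elements : List (List ℕ)
    unique   : Unique elements
    correct  : ∀ π → π ∈ elements ⇔ P π

open Enumeration public

count : ∀ {P} → Enumeration P → ℕ
count e = length (elements e)

strictLists : ℕ → List (List ℕ)
strictLists zero    = [] ∷ []
strictLists (suc m) = strictLists m ++ map (suc m ∷_) (strictLists m)

strictLists-bounded : ∀ m {p π} → (p ∷ π) ∈ strictLists m → p ≤ m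
strictLists-bounded zero    (here ())
strictLists-bounded zero    (there ())
strictLists-bounded (suc m) π∈ with ∈-++⁻ (strictLists m) π∈
... | inj₁ π∈ˡ = m≤n⇒m≤1+n (strictLists-bounded m π∈ˡ)
... | inj₂ π∈ʳ with ∈-map⁻ (suc m ∷_) π∈ʳ
...   | _ , _ , refl = ≤-refl

strictLists-unique : ∀ m → Unique (strictLists m)
strictLists-unique zero    = [] ∷ []
strictLists-unique (suc m) =
  Unique.++⁺ (strictLists-unique m)
             (Unique.map⁺ ∷-injectiveʳ (strictLists-unique m))
             disjoint
  where
  disjoint : ∀ {π} → ¬ (π ∈ strictLists m × π ∈ map (suc m ∷_) (strictLists m))
  disjoint (π∈ˡ , π∈ʳ) with ∈-map⁻ (suc m ∷_) π∈ʳ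
  ... | _ , _ , refl = <-irrefl refl (strictLists-bounded m π∈ˡ)

[]∈strictLists : ∀ m → [] ∈ strictLists m
[]∈strictLists zero    = here refl
[]∈strictLists (suc m) = ∈-++⁺ˡ ([]∈strictLists m)

strictLists-complete : ∀ m {p π} → All (_> 0) (p ∷ π) → Linked _>_ (p ∷ π) →
                       p ≤ m → (p ∷ π) ∈ strictLists m
strictLists-complete zero    (() ∷ _) _ z≤n
strictLists-complete (suc m) (p>0 ∷ π>0) π↘ p≤1+m with m≤n⇒m<n∨m≡n p≤1+m
... | inj₁ p<1+m =
  ∈-++⁺ˡ (strictLists-complete m (p>0 ∷ π>0) π↘ (s≤s⁻¹ p<1+m))
... | inj₂ refl = ∈-++⁺ʳ (strictLists m) (∈-map⁺ (suc m ∷_) (tail∈ π>0 π↘))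
  where
  tail∈ : ∀ {π} → All (_> 0) π → Linked _>_ (suc m ∷ π) → π ∈ strictLists m
  tail∈ []          _          = []∈strictLists m
  tail∈ (q>0 ∷ π>0) (q<p ∷ π↘) =
    strictLists-complete m (q>0 ∷ π>0) π↘ (s≤s⁻¹ q<p)

largest≤perimeter : ∀ p π → p ≤ perimeter (p ∷ π)
largest≤perimeter zero    π = z≤n
largest≤perimeter (suc p) π with xs≤max 0 (hookLengths (suc p ∷ π))
... | hook≤ ∷ _ =
  ≤-trans (subst (_≤ p + length (filter (0 <?_) π) + 1) (+-comm p 1)
                 (+-monoˡ-≤ 1 (m≤m+n p _)))
          hook≤

isPartition? : Decidable IsPartition
isPartition? π = nonempty? π ×-dec all? (_>? 0) π ×-dec linked? _≥?_ π
  where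
  nonempty? : Decidable (_≢ [])
  nonempty? []      = no λ []≢[] → []≢[] refl
  nonempty? (_ ∷ _) = yes λ ()

RDₒ? : ∀ n → Decidable (RDₒ n)
RDₒ? n π = isPartition? π ×-dec linked? _>?_ π ×-dec
           perimeter π ℕ.≟ n ×-dec #odd π >? #even π

RDₑ? : ∀ n → Decidable (RDₑ n)
RDₑ? n π = isPartition? π ×-dec linked? _>?_ π ×-dec
           perimeter π ℕ.≟ n ×-dec #even π >? #odd π

∈strictLists : ∀ {n} π → IsPartition π → DistinctParts π → perimeter π ≡ n →
               π ∈ strictLists n
∈strictLists []      (π≢[] , _)      _  _    = ⊥-elim (π≢[] refl)
∈strictLists (p ∷ π) (_ , π>0 , _) π↘ refl =
  strictLists-complete _ π>0 π↘ (largest≤perimeter p π)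

enumerate : ∀ {P : Pred (List ℕ) 0ℓ} n → Decidable P →
            (∀ π → P π → π ∈ strictLists n) → Enumeration P
enumerate n P? P⇒∈ = record
  { elements = filter P? (strictLists n)
  ; unique   = Unique.filter⁺ P? (strictLists-unique n)
  ; correct  = λ π → mk⇔ (λ π∈ → proj₂ (∈-filter⁻ P? {xs = strictLists n} π∈))
                         (λ Pπ → ∈-filter⁺ P? (P⇒∈ π Pπ) Pπ)
  }

enumerateRDₒ : ∀ n → Enumeration (RDₒ n)
enumerateRDₒ n = enumerate n (RDₒ? n) λ { π (part , dist , per , _) →
  ∈strictLists π part dist per }

enumerateRDₑ : ∀ n → Enumeration (RDₑ n)
enumerateRDₑ n = enumerate n (RDₑ? n) λ { π (part , dist , per , _) →
  ∈strictLists π part dist per }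

rdₒ rdₑ : ℕ → ℕ
rdₒ n = count (enumerateRDₒ n)
rdₑ n = count (enumerateRDₑ n)

{-# OPTIONS --safe #-}

-- Write M for the largest part, so that the remaining k = n - M parts form a
-- set of numbers below M. Exchanging 2i - 1 with 2i preserves the lists of
-- length k with parts up to 2j and swaps odd with even parts. Hence among the
-- partitions with M = 2j + 1 the odd-heavy ones win by the number of such lists
-- with #odd - #even ∈ {0 , 1}, and among those with M = 2j + 2 the even-heavy
-- ones win by the same expression. Summing over j gives
--   rdₒ n - rdₑ n = W (n - 1) - W (n - 2),   W n = U 0 n + U 1 n,
-- where U d n counts the pairs of j and a list with parts up to 2j, length
-- n - 2j and #odd - #even = d. Deciding whether 2j - 1 and 2j are parts gives
--   U d (4 + n) = U d (2 + n) + U (d - 1) (1 + n) + U (d + 1) (1 + n) + U d n,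
-- which together with U 2 n ≤ U 0 n shows that W increases from 7 on.
module Submission where

open import Defs
open import Data.Bool.Base using (Bool; true; false; if_then_else_; _∧_)
open import Data.List.Base
  using (List; []; _∷_; map; filter; length)
open import Data.List.Extrema.Nat using (xs≤max; max≤v⁺)
open import Data.List.Properties
  using (map-++; map-∘; map-cong-local; length-filter; filter-all)
open import Data.List.Relation.Unary.All as All using (All; []; _∷_)
import Data.List.Relation.Unary.All.Properties as All
open import Data.List.Relation.Unary.Linked as Linked
  using (Linked; [-]; _∷_)
open import Data.Nat.Base
  using (ℕ; zero; suc; parity; _+_; _*_; _∸_; _≤_; _<_; _≥_; _>_; _≡ᵇ_; _<ᵇ_
        ; z≤n; z<s; s<s⁻¹; _≤′_; ≤′-reflexive; ≤′-step)
open import Data.Nat.ListAction using (sum)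
open import Data.Nat.ListAction.Properties using (sum-++)
open import Data.Nat.Properties
open import Algebra.Properties.CommutativeSemigroup +-commutativeSemigroup
  using (interchange)
open import Data.Nat.Tactic.RingSolver using (solve-∀)
open import Data.Parity.Base using (Parity; 0ℙ; 1ℙ)
open import Data.Product.Base using (_×_; _,_)
open import Function.Base using (flip; _∘_)
open import Relation.Binary.PropositionalEquality
open import Relation.Nullary.Decidable using (does; dec-true)
open import Relation.Unary using (Pred; Decidable)
open import Level using (0ℓ)

-- Finite sums

⟦_⟧ : Bool → ℕ
⟦ b ⟧ = if b then 1 else 0

∑< : ℕ → (ℕ → ℕ) → ℕ
∑< zero    g = 0
∑< (suc n) g = ∑< n g + g n

∑-cong : ∀ n {g h} → (∀ i → g i ≡ h i) → ∑< n g ≡ ∑< n h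
∑-cong zero    g≡h = refl
∑-cong (suc n) g≡h = cong₂ _+_ (∑-cong n g≡h) (g≡h n)

∑-mono : ∀ n {g h} → (∀ i → g i ≤ h i) → ∑< n g ≤ ∑< n h
∑-mono zero    g≤h = z≤n
∑-mono (suc n) g≤h = +-mono-≤ (∑-mono n g≤h) (g≤h n)

∑-+ : ∀ n g h → ∑< n (λ i → g i + h i) ≡ ∑< n g + ∑< n h
∑-+ zero    g h = refl
∑-+ (suc n) g h rewrite ∑-+ n g h = interchange (∑< n g) (∑< n h) (g n) (h n)

∑-head : ∀ n g → ∑< (suc n) g ≡ g 0 + ∑< n (g ∘ suc)
∑-head zero    g = sym (+-identityʳ (g 0))
∑-head (suc n) g =
  trans (cong (_+ g (suc n)) (∑-head n g)) (+-assoc (g 0) _ _)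

∑-pairs : ∀ n g → ∑< (n * 2) g ≡ ∑< n (λ i → g (i * 2) + g (suc (i * 2)))
∑-pairs zero    g = refl
∑-pairs (suc n) g =
  trans (+-assoc (∑< (n * 2) g) _ _)
        (cong (_+ (g (n * 2) + g (suc (n * 2)))) (∑-pairs n g))

∑-extend : ∀ {n k g} → (∀ i → n ≤ i → g i ≡ 0) → n ≤′ k → ∑< k g ≡ ∑< n g
∑-extend g≡0 (≤′-reflexive refl) = refl
∑-extend g≡0 (≤′-step {k} n≤k)   =
  trans (cong₂ _+_ (∑-extend g≡0 n≤k) (g≡0 k (≤′⇒≤ n≤k))) (+-identityʳ _)

-- Weighted sums over strict lists

-- Functions ℕ → ℕ → ℕ are evaluated at the numbers of odd and even parts.

addPart : Parity → (ℕ → ℕ → ℕ) → ℕ → ℕ → ℕ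
addPart 1ℙ f a b = f (suc a) b
addPart 0ℙ f a b = f a (suc b)

addPart-cong : ∀ p {f g} → (∀ a b → f a b ≡ g a b) →
               ∀ a b → addPart p f a b ≡ addPart p g a b
addPart-cong 1ℙ f≡g a b = f≡g (suc a) b
addPart-cong 0ℙ f≡g a b = f≡g a (suc b)

addPart-+ : ∀ p f g a b → addPart p (λ x y → f x y + g x y) a b ≡
                          addPart p f a b + addPart p g a b
addPart-+ 1ℙ f g a b = refl
addPart-+ 0ℙ f g a b = refl

-- E m N f is the sum of f over the π in strictLists m with m + length π ≡ N.
E : ℕ → ℕ → (ℕ → ℕ → ℕ) → ℕ
E zero    zero          f = f 0 0
E zero    (suc N)       f = 0
E (suc m) zero          f = 0
E (suc m) (suc zero)    f = E m zero f
E (suc m) (suc (suc N)) f =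
  E m (suc N) f + E m N (addPart (parity (suc m)) f)

E-cong : ∀ m N {f g} → (∀ a b → f a b ≡ g a b) → E m N f ≡ E m N g
E-cong zero    zero          f≡g = f≡g 0 0
E-cong zero    (suc N)       f≡g = refl
E-cong (suc m) zero          f≡g = refl
E-cong (suc m) (suc zero)    f≡g = E-cong m zero f≡g
E-cong (suc m) (suc (suc N)) f≡g =
  cong₂ _+_ (E-cong m (suc N) f≡g)
            (E-cong m N (addPart-cong (parity (suc m)) f≡g))

E-+ : ∀ m N f g → E m N (λ a b → f a b + g a b) ≡ E m N f + E m N g
E-+ zero    zero          f g = refl
E-+ zero    (suc N)       f g = refl
E-+ (suc m) zero          f g = refl
E-+ (suc m) (suc zero)    f g = E-+ m zero f g
E-+ (suc m) (suc (suc N)) f g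
  rewrite E-+ m (suc N) f g
        | E-cong m N (addPart-+ (parity (suc m)) f g)
        | E-+ m N (addPart (parity (suc m)) f) (addPart (parity (suc m)) g) =
  interchange (E m (suc N) f) (E m (suc N) g) _ _

-- The lists would need the negative length `N - m`.
E-vanish : ∀ m N f → N < m → E m N f ≡ 0
E-vanish (suc m) zero          f _   = refl
E-vanish (suc m) (suc zero)    f N<m = E-vanish m zero f (s<s⁻¹ N<m)
E-vanish (suc m) (suc (suc N)) f N<m =
  cong₂ _+_ (E-vanish m (suc N) f (s<s⁻¹ N<m))
            (E-vanish m N _ (<-trans (n<1+n N) (s<s⁻¹ N<m)))

-- Even bounds and the exchange of odd with even parts

parity[n*2] : ∀ n → parity (n * 2) ≡ 0ℙ
parity[n*2] zero    = refl
parity[n*2] (suc n) = parity[n*2] n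

parity[1+n*2] : ∀ n → parity (suc (n * 2)) ≡ 1ℙ
parity[1+n*2] zero    = refl
parity[1+n*2] (suc n) = parity[1+n*2] n

-- Four cases, by whether `2j + 1` and `2j + 2` are parts. Lowering the bound takes 2 from `4 + N`,
-- and each of these parts that is present takes 1 more.
E-even-rec : ∀ j N f →
  E (suc j * 2) (4 + N) f ≡
  E (j * 2) (2 + N) f +
  (E (j * 2) (1 + N) (addPart 1ℙ f) + E (j * 2) (1 + N) (addPart 0ℙ f) +
   E (j * 2) N (addPart 1ℙ (addPart 0ℙ f)))
E-even-rec j N f rewrite parity[n*2] j | parity[1+n*2] j =
  trans (+-assoc (E (j * 2) (2 + N) f) _ _)
        (cong (E (j * 2) (2 + N) f +_)
              (sym (+-assoc (E (j * 2) (1 + N) (addPart 1ℙ f)) _ _)))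

E-even-3 : ∀ j f →
  E (suc j * 2) 3 f ≡
  E (j * 2) 1 f + (E (j * 2) 0 (addPart 1ℙ f) + E (j * 2) 0 (addPart 0ℙ f))
E-even-3 j f rewrite parity[n*2] j | parity[1+n*2] j =
  +-assoc (E (j * 2) 1 f) _ _

-- No bijection is built: under `flip` the two middle terms of the recurrence trade places, and the
-- outer two are symmetric by induction.
E-even-swap : ∀ j N f → E (j * 2) N (flip f) ≡ E (j * 2) N f
E-even-swap zero    zero    f = refl
E-even-swap zero    (suc N) f = refl
E-even-swap (suc j) 0 f = refl
E-even-swap (suc j) 1 f = refl
E-even-swap (suc j) 2 f = cong (_+ 0) (E-even-swap j 0 f)
E-even-swap (suc j) 3 f
  rewrite E-even-3 j (flip f) | E-even-3 j f
        | E-even-swap j 1 f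
        | E-even-swap j 0 (addPart 1ℙ f)
        | E-even-swap j 0 (addPart 0ℙ f) =
  cong (E (j * 2) 1 f +_) (+-comm (E (j * 2) 0 (addPart 0ℙ f)) _)
E-even-swap (suc j) (suc (suc (suc (suc N)))) f
  rewrite E-even-rec j N (flip f) | E-even-rec j N f
        | E-even-swap j (2 + N) f
        | E-even-swap j (1 + N) (addPart 1ℙ f)
        | E-even-swap j (1 + N) (addPart 0ℙ f)
        | E-even-swap j N (addPart 1ℙ (addPart 0ℙ f)) =
  cong (λ x → E (j * 2) (2 + N) f +
              (x + E (j * 2) N (addPart 1ℙ (addPart 0ℙ f))))
       (+-comm (E (j * 2) (1 + N) (addPart 0ℙ f)) _)

-- Distribution of the difference #odd - #even

excess : ℕ → ℕ → ℕ → ℕ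
excess d a b = ⟦ d + b ≡ᵇ a ⟧

≡ᵇ-sym : ∀ m n → (m ≡ᵇ n) ≡ (n ≡ᵇ m)
≡ᵇ-sym zero    zero    = refl
≡ᵇ-sym zero    (suc n) = refl
≡ᵇ-sym (suc m) zero    = refl
≡ᵇ-sym (suc m) (suc n) = ≡ᵇ-sym m n

addEven-excess : ∀ d a b → addPart 0ℙ (excess d) a b ≡ excess (suc d) a b
addEven-excess d a b = cong (λ x → ⟦ x ≡ᵇ a ⟧) (+-suc d b)

addBoth-excess : ∀ d a b →
  addPart 1ℙ (addPart 0ℙ (excess d)) a b ≡ excess d a b
addBoth-excess d a b = cong (λ x → ⟦ x ≡ᵇ suc a ⟧) (+-suc d b)

-- The condition becomes difference -1, which no `excess d` expresses; with the two counts exchanged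
-- it is difference 1.
addOdd-excess0 : ∀ a b → addPart 1ℙ (excess 0) a b ≡ flip (excess 1) a b
addOdd-excess0 a b = cong ⟦_⟧ (≡ᵇ-sym b (suc a))

E-even-addOdd-excess0 : ∀ j N →
  E (j * 2) N (addPart 1ℙ (excess 0)) ≡ E (j * 2) N (excess 1)
E-even-addOdd-excess0 j N =
  trans (E-cong (j * 2) N addOdd-excess0) (E-even-swap j N (excess 1))

-- The extra part shifts `d` to `d - 1` and `d + 1`, and the shifted terms compare one by one. At
-- `d = 0` the shift to -1 is reflected to 1, and only the values at 3 and 1 remain to be compared.
E-even-addOne-excess-≤ : ∀ {j N} →
  (∀ d → E (j * 2) N (excess (2 + d)) ≤ E (j * 2) N (excess d)) →
  ∀ d → E (j * 2) N (addPart 1ℙ (excess (2 + d))) +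
        E (j * 2) N (addPart 0ℙ (excess (2 + d))) ≤
        E (j * 2) N (addPart 1ℙ (excess d)) +
        E (j * 2) N (addPart 0ℙ (excess d))
E-even-addOne-excess-≤ {j} {N} unimodal zero
  rewrite E-even-addOdd-excess0 j N
        | E-cong (j * 2) N (addEven-excess 2)
        | E-cong (j * 2) N (addEven-excess 0) =
  +-monoʳ-≤ (E (j * 2) N (excess 1)) (unimodal 1)
E-even-addOne-excess-≤ {j} {N} unimodal (suc d)
  rewrite E-cong (j * 2) N (addEven-excess (3 + d))
        | E-cong (j * 2) N (addEven-excess (1 + d)) =
  +-mono-≤ (unimodal d) (unimodal (2 + d))

-- The distribution is symmetric about 0 and falls away from it, which the recurrence preserves.
-- Steps of two are natural, since the difference has the parity of the length `N - 2j`.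
E-even-excess-≤ : ∀ j N d →
  E (j * 2) N (excess (2 + d)) ≤ E (j * 2) N (excess d)
E-even-excess-≤ zero    zero    d = z≤n
E-even-excess-≤ zero    (suc N) d = z≤n
E-even-excess-≤ (suc j) 0 d = z≤n
E-even-excess-≤ (suc j) 1 d = z≤n
E-even-excess-≤ (suc j) 2 d = +-monoˡ-≤ 0 (E-even-excess-≤ j 0 d)
E-even-excess-≤ (suc j) 3 d
  rewrite E-even-3 j (excess (2 + d)) | E-even-3 j (excess d) =
  +-mono-≤ (E-even-excess-≤ j 1 d)
           (E-even-addOne-excess-≤ {j} (E-even-excess-≤ j 0) d)
E-even-excess-≤ (suc j) (suc (suc (suc (suc N)))) d
  rewrite E-even-rec j N (excess (2 + d)) | E-even-rec j N (excess d)
        | E-cong (j * 2) N (addBoth-excess (2 + d))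
        | E-cong (j * 2) N (addBoth-excess d) =
  +-mono-≤ (E-even-excess-≤ j (2 + N) d)
           (+-mono-≤ (E-even-addOne-excess-≤ {j} (E-even-excess-≤ j (1 + N)) d)
                     (E-even-excess-≤ j N d))

-- Sums over all even bounds

-- The sum of E (j * 2) N f over all j: the terms with j > N vanish.
T : ℕ → (ℕ → ℕ → ℕ) → ℕ
T N f = ∑< (suc N) (λ j → E (j * 2) N f)

T-extend : ∀ {N k} f → suc N ≤ k → ∑< k (λ j → E (j * 2) N f) ≡ T N f
T-extend {N} f N<k =
  ∑-extend (λ j N<j → E-vanish (j * 2) N f (<-≤-trans N<j (m≤m*n j 2)))
           (≤⇒≤′ N<k)

T-cong : ∀ N {f g} → (∀ a b → f a b ≡ g a b) → T N f ≡ T N g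
T-cong N f≡g = ∑-cong (suc N) λ j → E-cong (j * 2) N f≡g

T-+ : ∀ N f g → T N (λ a b → f a b + g a b) ≡ T N f + T N g
T-+ N f g =
  trans (∑-cong (suc N) λ j → E-+ (j * 2) N f g) (∑-+ (suc N) _ _)

T-swap : ∀ N f → T N (flip f) ≡ T N f
T-swap N f = ∑-cong (suc N) λ j → E-even-swap j N f

T-rec : ∀ N f → T (4 + N) f ≡
  T (2 + N) f + (T (1 + N) (addPart 1ℙ f) + T (1 + N) (addPart 0ℙ f) +
                 T N (addPart 1ℙ (addPart 0ℙ f)))
T-rec N f = begin
  T (4 + N) f
    -- The term at `j = 0` computes to 0: the only list there is empty, and `4 + N` is positive.
    ≡⟨ ∑-head (4 + N) _ ⟩
  ∑< (4 + N) (λ j → E (suc j * 2) (4 + N) f)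
    ≡⟨ ∑-cong (4 + N) (λ j → E-even-rec j N f) ⟩
  ∑< (4 + N) (λ j → A j + (B j + C j + D j))
    ≡⟨ ∑-+ (4 + N) A _ ⟩
  ∑< (4 + N) A + ∑< (4 + N) (λ j → B j + C j + D j)
    ≡⟨ cong (∑< (4 + N) A +_) (∑-+ (4 + N) (λ j → B j + C j) D) ⟩
  ∑< (4 + N) A + (∑< (4 + N) (λ j → B j + C j) + ∑< (4 + N) D)
    ≡⟨ cong (λ x → ∑< (4 + N) A + (x + ∑< (4 + N) D)) (∑-+ (4 + N) B C) ⟩
  ∑< (4 + N) A + (∑< (4 + N) B + ∑< (4 + N) C + ∑< (4 + N) D)
    -- The range `4 + N` exceeds what each `T` sums over, but the surplus terms vanish.
    ≡⟨ cong₂ _+_ (T-extend f (m≤n+m (3 + N) 1))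
         (cong₂ _+_
           (cong₂ _+_ (T-extend (addPart 1ℙ f) (m≤n+m (2 + N) 2))
                      (T-extend (addPart 0ℙ f) (m≤n+m (2 + N) 2)))
           (T-extend (addPart 1ℙ (addPart 0ℙ f)) (m≤n+m (1 + N) 3))) ⟩
  T (2 + N) f + (T (1 + N) (addPart 1ℙ f) + T (1 + N) (addPart 0ℙ f) +
                 T N (addPart 1ℙ (addPart 0ℙ f))) ∎
  where
  open ≡-Reasoning
  A B C D : ℕ → ℕ
  A j = E (j * 2) (2 + N) f
  B j = E (j * 2) (1 + N) (addPart 1ℙ f)
  C j = E (j * 2) (1 + N) (addPart 0ℙ f)
  D j = E (j * 2) N (addPart 1ℙ (addPart 0ℙ f))

-- Recurrences for `U` and growth of `W`

U : ℕ → ℕ → ℕ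
U d N = T N (excess d)

-- The difference `d - 1 = -1` is reflected to 1, hence the repeated term.
U-rec-zero : ∀ N →
  U 0 (4 + N) ≡ U 0 (2 + N) + (U 1 (1 + N) + U 1 (1 + N) + U 0 N)
U-rec-zero N
  rewrite T-rec N (excess 0)
        | T-cong (1 + N) addOdd-excess0
        | T-swap (1 + N) (excess 1) = refl

U-rec-suc : ∀ d N →
  U (suc d) (4 + N) ≡
  U (suc d) (2 + N) + (U d (1 + N) + U (2 + d) (1 + N) + U (suc d) N)
U-rec-suc d N
  rewrite T-rec N (excess (suc d))
        | T-cong (1 + N) (addEven-excess (suc d))
        | T-cong N (addBoth-excess (suc d)) = refl

U2≤U0 : ∀ N → U 2 N ≤ U 0 N
U2≤U0 N = ∑-mono (suc N) λ j → E-even-excess-≤ j N 0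

W : ℕ → ℕ
W N = U 0 N + U 1 N

W[2+N]≤W[4+N] : ∀ N → W (2 + N) ≤ W (4 + N)
W[2+N]≤W[4+N] N rewrite U-rec-zero N | U-rec-suc 0 N =
  +-mono-≤ (m≤m+n (U 0 (2 + N)) _) (m≤m+n (U 1 (2 + N)) _)

W>0 : ∀ N → W (2 + N) > 0
-- The base values at 2 and 3 are evaluated; with `j = 1` they count the empty list and the list
-- `1 ∷ []`.
W>0 zero          = z<s
W>0 (suc zero)    = z<s
W>0 (suc (suc N)) = <-≤-trans (W>0 N) (W[2+N]≤W[4+N] N)

-- Expand `W (7 + N)` once, and `W (8 + N)` once more at its terms of index `6 + N`. After bounding
-- `U 2 (4 + N)` by `U 0 (4 + N)`, every term of the former cancels, and the surplus contains
-- `W (2 + N)`, which gives strictness.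
W-increasing : ∀ N → W (7 + N) < W (8 + N)
W-increasing N = begin-strict
  W (7 + N)
    ≡⟨ cong₂ _+_ (U-rec-zero (3 + N)) (U-rec-suc 0 (3 + N)) ⟩
  w7 (U 2 (4 + N))
    ≤⟨ +-monoʳ-≤ (a5 + (b4 + b4 + a3))
         (+-monoʳ-≤ b5 (+-monoˡ-≤ b3 (+-monoʳ-≤ a4 (U2≤U0 (4 + N))))) ⟩
  w7 a4
    <⟨ m<m+n (w7 a4) (W>0 N) ⟩
  w7 a4 + (a2 + b2)
    ≤⟨ m≤m+n _ (b3 + b5 + c3 + c5) ⟩
  w7 a4 + (a2 + b2) + (b3 + b5 + c3 + c5)
    ≡⟨ regroup a2 a3 a4 a5 b2 b3 b4 b5 c3 c5 ⟩
  (a4 + (b3 + b3 + a2)) + (b5 + b5 + a4) +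
  ((b4 + (a3 + c3 + b2)) + (a5 + c5 + b4))
    ≡⟨ cong₂ (λ x y → x + (b5 + b5 + a4) + (y + (a5 + c5 + b4)))
             (U-rec-zero (2 + N)) (U-rec-suc 0 (2 + N)) ⟨
  U 0 (6 + N) + (b5 + b5 + a4) + (U 1 (6 + N) + (a5 + c5 + b4))
    ≡⟨ cong₂ _+_ (U-rec-zero (4 + N)) (U-rec-suc 0 (4 + N)) ⟨
  W (8 + N) ∎
  where
  open ≤-Reasoning
  a2 a3 a4 a5 b2 b3 b4 b5 c3 c5 : ℕ
  a2 = U 0 (2 + N)
  a3 = U 0 (3 + N)
  a4 = U 0 (4 + N)
  a5 = U 0 (5 + N)
  b2 = U 1 (2 + N)
  b3 = U 1 (3 + N)
  b4 = U 1 (4 + N)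
  b5 = U 1 (5 + N)
  c3 = U 2 (3 + N)
  c5 = U 2 (5 + N)
  w7 : ℕ → ℕ
  w7 c4 = a5 + (b4 + b4 + a3) + (b5 + (a4 + c4 + b3))
  regroup : ∀ a2 a3 a4 a5 b2 b3 b4 b5 c3 c5 →
    a5 + (b4 + b4 + a3) + (b5 + (a4 + a4 + b3)) + (a2 + b2) +
    (b3 + b5 + c3 + c5) ≡
    (a4 + (b3 + b3 + a2)) + (b5 + b5 + a4) +
    ((b4 + (a3 + c3 + b2)) + (a5 + c5 + b4))
  regroup = solve-∀

-- The perimeter of a partition into distinct parts

-- In the first row, at most all `length π` later rows lie below a box. Passing to a lower row
-- decreases both the largest part and the number of parts.
hookLengths-≤ : ∀ p π → Linked _>_ (p ∷ π) →
                All (_≤ p + length π) (hookLengths (p ∷ π))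
hookLengths-≤ p π π↘ =
  All.++⁺ (All.map⁺ (All.applyUpTo⁺₁ _ p firstRow)) (lowerRows π π↘)
  where
  firstRow : ∀ {j} → j < p →
             (p ∸ suc j) + length (filter (j <?_) π) + 1 ≤ p + length π
  firstRow {j} j<p = begin
    (p ∸ suc j) + length (filter (j <?_) π) + 1
      ≤⟨ +-monoˡ-≤ 1 (+-monoʳ-≤ (p ∸ suc j) (length-filter (j <?_) π)) ⟩
    (p ∸ suc j) + length π + 1
      ≡⟨ move (p ∸ suc j) (length π) ⟩
    (p ∸ suc j) + 1 + length π
      ≤⟨ +-monoˡ-≤ (length π) (+-monoʳ-≤ (p ∸ suc j) z<s) ⟩
    (p ∸ suc j) + suc j + length π
      ≡⟨ cong (_+ length π) (m∸n+n≡m j<p) ⟩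
    p + length π ∎
    where
    open ≤-Reasoning
    move : ∀ x y → x + y + 1 ≡ x + 1 + y
    move = solve-∀
  lowerRows : ∀ π → Linked _>_ (p ∷ π) →
              All (_≤ p + length π) (hookLengths π)
  lowerRows []      _           = []
  lowerRows (q ∷ π) (q<p ∷ π↘) =
    All.map (λ h≤ → ≤-trans h≤ (+-mono-≤ (<⇒≤ q<p) (n≤1+n (length π))))
            (hookLengths-≤ q π π↘)

-- The corner box attains the bound, because every later row is nonempty and so meets column 0.
perimeter-strict : ∀ p π → All (_> 0) π → Linked _>_ (suc p ∷ π) →
                   perimeter (suc p ∷ π) ≡ suc p + length π
perimeter-strict p π π>0 π↘ =
  ≤-antisym (max≤v⁺ z≤n (hookLengths-≤ (suc p) π π↘)) corner
  where
  corner : suc p + length π ≤ perimeter (suc p ∷ π)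
  corner = subst (_≤ perimeter (suc p ∷ π))
    (trans (cong (λ ρ → p + length ρ + 1) (filter-all (0 <?_) π>0))
           (+-comm (p + length π) 1))
    (All.head (xs≤max 0 (hookLengths (suc p ∷ π))))

-- Sums over `strictLists`

-- Linking `π` to `suc m` puts the bound `m` and the strict decrease into one condition, ready for
-- `suc m ∷ π`.
Below : ℕ → Pred (List ℕ) 0ℓ
Below m π = All (_> 0) π × Linked _>_ (suc m ∷ π)

strictLists-below : ∀ m → All (Below m) (strictLists m)
strictLists-below zero    = ([] , [-]) ∷ []
strictLists-below (suc m) =
  All.++⁺ (All.map weaken (strictLists-below m))
          (All.map⁺ (All.map extend (strictLists-below m)))
  where
  weaken : ∀ {π} → Below m π → Below (suc m) π
  weaken (π>0 , [-])      = π>0 , [-]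
  weaken (π>0 , q<m ∷ π↘) = π>0 , m≤n⇒m≤1+n q<m ∷ π↘
  extend : ∀ {π} → Below m π → Below (suc m) (suc m ∷ π)
  extend (π>0 , π↘) = z<s ∷ π>0 , ≤-refl ∷ π↘

∑strict : ℕ → (List ℕ → ℕ) → ℕ
∑strict m g = sum (map g (strictLists m))

∑strict-cong : ∀ m {g h} → (∀ π → Below m π → g π ≡ h π) →
               ∑strict m g ≡ ∑strict m h
∑strict-cong m g≡h =
  cong sum (map-cong-local
    (All.map (λ {π} → g≡h π) (strictLists-below m)))

∑strict-suc : ∀ m g →
  ∑strict (suc m) g ≡ ∑strict m g + ∑strict m (g ∘ (suc m ∷_))
∑strict-suc m g
  rewrite map-++ g (strictLists m) (map (suc m ∷_) (strictLists m))
        | sum-++ (map g (strictLists m)) (map g (map (suc m ∷_) (strictLists m)))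
        | map-∘ {g = g} {f = suc m ∷_} (strictLists m) = refl

∑strict-largest : ∀ n g →
  ∑strict n g ≡ g [] + ∑< n (λ m → ∑strict m (g ∘ (suc m ∷_)))
∑strict-largest zero    g = refl
∑strict-largest (suc n) g =
  trans (∑strict-suc n g)
        (trans (cong (_+ ∑strict n (g ∘ (suc n ∷_))) (∑strict-largest n g))
               (+-assoc (g []) _ _))

∑strict-zero : ∀ m {g} → (∀ π → g π ≡ 0) → ∑strict m g ≡ 0
∑strict-zero m {g} g≡0 = go (strictLists m)
  where
  go : ∀ πs → sum (map g πs) ≡ 0
  go []       = refl
  go (π ∷ πs) = cong₂ _+_ (g≡0 π) (go πs)

#parts-∷ : ∀ (f : ℕ → ℕ → ℕ) p π →
  f (#odd (p ∷ π)) (#even (p ∷ π)) ≡ addPart (parity p) f (#odd π) (#even π)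
#parts-∷ f p π with parity p
... | 0ℙ = refl
... | 1ℙ = refl

weigh : ℕ → ℕ → (ℕ → ℕ → ℕ) → List ℕ → ℕ
weigh m N f π = if m + length π ≡ᵇ N then f (#odd π) (#even π) else 0

∑strict-weigh : ∀ m N f → ∑strict m (weigh m N f) ≡ E m N f
∑strict-weigh zero    zero          f = +-identityʳ (f 0 0)
∑strict-weigh zero    (suc N)       f = refl
∑strict-weigh (suc m) zero          f = ∑strict-zero (suc m) λ _ → refl
∑strict-weigh (suc m) (suc zero)    f =
  trans (∑strict-suc m (weigh (suc m) 1 f))
        (trans (cong₂ _+_ (∑strict-weigh m zero f) (∑strict-zero m tooLong))
               (+-identityʳ _))
  where
  -- With the part `suc m` present, bound plus length is at least 2.
  tooLong : ∀ π → weigh (suc m) 1 f (suc m ∷ π) ≡ 0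
  tooLong π rewrite +-suc m (length π) = refl
∑strict-weigh (suc m) (suc (suc N)) f =
  trans (∑strict-suc m (weigh (suc m) (2 + N) f))
        (cong₂ _+_ (∑strict-weigh m (suc N) f)
                   (trans (∑strict-cong m λ π _ → cons π)
                          (∑strict-weigh m N _)))
  where
  cons : ∀ π → weigh (suc m) (2 + N) f (suc m ∷ π) ≡
               weigh m N (addPart (parity (suc m)) f) π
  cons π rewrite +-suc m (length π) =
    cong (λ x → if m + length π ≡ᵇ N then x else 0) (#parts-∷ f (suc m) π)

-- The two counts as sums over the largest part

length-filter-sum : ∀ {P : Pred (List ℕ) 0ℓ} (P? : Decidable P) πs →
                    length (filter P? πs) ≡ sum (map (⟦_⟧ ∘ does ∘ P?) πs)
length-filter-sum P? []       = refl
length-filter-sum P? (π ∷ πs) with does (P? π)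
... | true  = cong suc (length-filter-sum P? πs)
... | false = length-filter-sum P? πs

more : ℕ → ℕ → ℕ
more a b = ⟦ b <ᵇ a ⟧

module _ {N : ℕ} {P : Pred (List ℕ) 0ℓ} (P? : Decidable P) (f : ℕ → ℕ → ℕ)
         (does-[] : does (P? []) ≡ false)
         (does-∷  : ∀ m π → Below m π →
                    ⟦ does (P? (suc m ∷ π)) ⟧ ≡
                    weigh m N (addPart (parity (suc m)) f) π) where

  length-filter-strictLists :
    length (filter P? (strictLists (suc N))) ≡
    ∑< (suc N) (λ m → E m N (addPart (parity (suc m)) f))
  length-filter-strictLists
    rewrite length-filter-sum P? (strictLists (suc N))
          | ∑strict-largest (suc N) (⟦_⟧ ∘ does ∘ P?)
          | does-[] =
    ∑-cong (suc N) λ m → trans (∑strict-cong m (does-∷ m)) (∑strict-weigh m N _)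

-- By `perimeter-strict` the perimeter test reads `suc m + length π ≡ suc N`, which is the test in
-- `weigh m N`; the first two tests succeed, and `c` is the comparison of odd with even parts.
does-RD : ∀ m N π c (f : ℕ → ℕ → ℕ) → Below m π →
  f (#odd (suc m ∷ π)) (#even (suc m ∷ π)) ≡ ⟦ c ⟧ →
  ⟦ does (isPartition? (suc m ∷ π)) ∧ does (Linked.linked? _>?_ (suc m ∷ π)) ∧
    does (perimeter (suc m ∷ π) ≟ suc N) ∧ c ⟧ ≡
  weigh m N (addPart (parity (suc m)) f) π
does-RD m N π c f (π>0 , π↘) f≡c =
  trans (conjunction (dec-true (isPartition? (suc m ∷ π))
                               ((λ ()) , z<s ∷ π>0 , Linked.map <⇒≤ π↘))
                     (dec-true (Linked.linked? _>?_ (suc m ∷ π)) π↘)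
                     (cong (λ x → does (x ≟ suc N)) (perimeter-strict m π π>0 π↘)))
        (cong (λ x → if m + length π ≡ᵇ N then x else 0)
              (trans (sym f≡c) (#parts-∷ f (suc m) π)))
  where
  conjunction : ∀ {p q r s} → p ≡ true → q ≡ true → r ≡ s →
                ⟦ p ∧ q ∧ r ∧ c ⟧ ≡ (if s then ⟦ c ⟧ else 0)
  conjunction {s = true}  refl refl refl = refl
  conjunction {s = false} refl refl refl = refl

rdₒ-as-sum : ∀ N →
  rdₒ (suc N) ≡ ∑< (suc N) (λ m → E m N (addPart (parity (suc m)) more))
rdₒ-as-sum N = length-filter-strictLists (RDₒ? (suc N)) more refl
  λ m π π↘ → does-RD m N π _ more π↘ refl

rdₑ-as-sum : ∀ N →
  rdₑ (suc N) ≡ ∑< (suc N) (λ m → E m N (addPart (parity (suc m)) (flip more)))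
rdₑ-as-sum N = length-filter-strictLists (RDₑ? (suc N)) (flip more) refl
  λ m π π↘ → does-RD m N π _ (flip more) π↘ refl

-- Comparison of the two counts

-- The three terms come from the odd largest part 2j + 1, and from the even
-- largest part 2j + 2 without and with the part 2j + 1. The last one absorbs
-- both shifts into the hypothesis.
∑-by-parity : ∀ N f → (∀ a b → f (suc a) (suc b) ≡ f a b) →
  ∑< (3 + N) (λ m → E m (2 + N) (addPart (parity (suc m)) f)) ≡
  T (2 + N) (addPart 1ℙ f) + (T (1 + N) (addPart 0ℙ f) + T N f)
∑-by-parity N f f-diff = begin
  ∑< (3 + N) g
    ≡⟨ ∑-extend (λ m N<m → E-vanish m (2 + N) _ N<m)
                (≤⇒≤′ (m≤m*n (3 + N) 2)) ⟨
  ∑< ((3 + N) * 2) g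
    ≡⟨ ∑-pairs (3 + N) g ⟩
  ∑< (3 + N) (λ j → g (j * 2) + g (suc (j * 2)))
    ≡⟨ ∑-cong (3 + N) pair ⟩
  ∑< (3 + N) (λ j → A j + (B j + C j))
    ≡⟨ ∑-+ (3 + N) A _ ⟩
  ∑< (3 + N) A + ∑< (3 + N) (λ j → B j + C j)
    ≡⟨ cong (∑< (3 + N) A +_) (∑-+ (3 + N) B C) ⟩
  ∑< (3 + N) A + (∑< (3 + N) B + ∑< (3 + N) C)
    ≡⟨ cong (∑< (3 + N) A +_)
         (cong₂ _+_ (T-extend (addPart 0ℙ f) (m≤n+m (2 + N) 1))
                    (T-extend f (m≤n+m (1 + N) 2))) ⟩
  T (2 + N) (addPart 1ℙ f) + (T (1 + N) (addPart 0ℙ f) + T N f) ∎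
  where
  open ≡-Reasoning
  g A B C : ℕ → ℕ
  g m = E m (2 + N) (addPart (parity (suc m)) f)
  A j = E (j * 2) (2 + N) (addPart 1ℙ f)
  B j = E (j * 2) (1 + N) (addPart 0ℙ f)
  C j = E (j * 2) N f
  pair : ∀ j → g (j * 2) + g (suc (j * 2)) ≡ A j + (B j + C j)
  pair j rewrite parity[1+n*2] j | parity[n*2] j =
    cong (λ x → A j + (B j + x)) (E-cong (j * 2) N f-diff)

-- An extra odd part leaves `a - b ≥ 0` to be satisfied, an extra even part `a - b ≥ 2`; the
-- differences 0 and 1 lie between.
more-split : ∀ a b → addPart 1ℙ more a b ≡
                     addPart 0ℙ more a b + (excess 0 a b + excess 1 a b)
more-split zero          zero    = refl
more-split (suc zero)    zero    = refl
more-split (suc (suc a)) zero    = refl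
more-split zero          (suc b) = refl
more-split (suc a)       (suc b) = more-split a b

T-more-split : ∀ N → T N (addPart 1ℙ more) ≡ T N (addPart 0ℙ more) + W N
T-more-split N =
  trans (T-cong N more-split)
        (trans (T-+ N (addPart 0ℙ more) _)
               (cong (T N (addPart 0ℙ more) +_) (T-+ N (excess 0) (excess 1))))

-- The exchange turns `flip more` back into `more` with `addPart 1ℙ` and `addPart 0ℙ` interchanged,
-- so `T N more` is common to both counts. The `W` terms are placed so as to avoid subtraction.
rdₒ-rdₑ-balance : ∀ N → rdₒ (3 + N) + W (1 + N) ≡ rdₑ (3 + N) + W (2 + N)
rdₒ-rdₑ-balance N
  rewrite rdₒ-as-sum (2 + N) | rdₑ-as-sum (2 + N)
        | ∑-by-parity N more (λ _ _ → refl)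
        | ∑-by-parity N (flip more) (λ _ _ → refl)
        | T-swap (2 + N) (addPart 0ℙ more)
        | T-swap (1 + N) (addPart 1ℙ more)
        | T-swap N more
        | T-more-split (2 + N) | T-more-split (1 + N) =
  regroup (T (2 + N) (addPart 0ℙ more)) (W (2 + N))
          (T (1 + N) (addPart 0ℙ more)) (W (1 + N)) (T N more)
  where
  regroup : ∀ x w y v z → x + w + (y + z) + v ≡ x + (y + v + z) + w
  regroup = solve-∀

theorem1p3 : (n : ℕ) → n ≥ 9 → rdₒ n > rdₑ n
theorem1p3 n n≥9 with m≤n⇒∃[o]m+o≡n n≥9
-- The bound 9 is the index 7 at which `W-increasing` starts, plus the 2 of `W (n - 2)`.
... | k , refl = +-cancelʳ-< (W (7 + k)) (rdₑ (9 + k)) (rdₒ (9 + k)) (begin-strict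
  rdₑ (9 + k) + W (7 + k)  <⟨ +-monoʳ-< (rdₑ (9 + k)) (W-increasing k) ⟩
  rdₑ (9 + k) + W (8 + k)  ≡⟨ rdₒ-rdₑ-balance (6 + k) ⟨
  rdₒ (9 + k) + W (7 + k)  ∎)
  where open ≤-Reasoning
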